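{- Let $k, n, m, s \ge 2$ be integers. Suppose there is an $n$-coloring $G$ of the edges of the complete graph $K_s$ (colors $1,\dots,n$) containing no monochromatic $K_k$ in any color, and suppose there is a set of $m$ vertices of $K_s$ such that the edges among these $m$ vertices receive, under $G$, fewer than $n$ distinct colors. Then $$R_{2n}(k) \ge s^2 + m\bigl(R_n(k-1,\underbrace{k,\dots,k}_{n-1})-1\bigr)+1 .$$
   Context: All colorings are edge-colorings of complete graphs. For integers $n\ge1$ and $k_1,\dots,k_n\ge1$, a $(k_1,\dots,k_n)$-coloring is an assignment of one of $n$ colors $1,\dots,n$ to each edge of a complete graph such that for each $i$ there is no complete subgraph $K_{k_i}$ all of whose edges have color $i$. The Ramsey number $R(k_1,\dots,k_n)$ (also written $R_n(k_1,\dots,k_n)$) is the least $s>0$ such that no $(k_1,\dots,k_n)$-coloring of $K_s$ exists. In the diagonal case $k_1=\dots=k_n=k$ this number is denoted $R_n(k)$. -}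

module Defs where

open import Data.Nat using (ℕ; zero; suc; _+_; _*_; _∸_; _^_; _<_; _≤_)
open import Data.Fin using (Fin; zero; suc)
open import Data.Fin.Subset using (Subset; _∈_; ∣_∣)
open import Data.Product using (Σ; ∃; _×_; _,_)
open import Relation.Binary.PropositionalEquality using (_≡_; _≢_)
open import Relation.Nullary using (¬_)
open import Function.Definitions using (Injective)

-- An n-coloring of the edges of the complete graph K_s (vertices Fin s,
-- colors Fin n).  Only values on pairs of distinct vertices matter;
-- symmetry makes it a coloring of undirected edges.
record Coloring (s n : ℕ) : Set where
  field
    col : Fin s → Fin s → Fin n
    sym : ∀ u v → col u v ≡ col v u
open Coloring public

MonoClique : ∀ {s n} → Coloring s n → (c : Fin n) → (k : ℕ) → Set
MonoClique {s} G c k =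
  Σ (Fin k → Fin s) λ f → Injective _≡_ _≡_ f × (∀ i j → i ≢ j → col G (f i) (f j) ≡ c)

IsRamseyColoring : ∀ {s n} → (ks : Fin n → ℕ) → Coloring s n → Set
IsRamseyColoring ks G = ∀ c → ¬ MonoClique G c (ks c)

HasRamseyColoring : (n : ℕ) → (ks : Fin n → ℕ) → (s : ℕ) → Set
HasRamseyColoring n ks s = Σ (Coloring s n) (IsRamseyColoring ks)

IsRamseyNumber : (n : ℕ) → (ks : Fin n → ℕ) → (r : ℕ) → Set
IsRamseyNumber n ks r =
  0 < r × ¬ HasRamseyColoring n ks r × (∀ t → 0 < t → t < r → HasRamseyColoring n ks t)

diag : (n k : ℕ) → Fin n → ℕ
diag n k _ = k

firstMinus : (n k : ℕ) → Fin n → ℕ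
firstMinus (suc n) k zero = k ∸ 1
firstMinus (suc n) k (suc _) = k

FewerColorsOn : ∀ {s n m} → Coloring s n → (Fin m → Fin s) → Set
FewerColorsOn {s} {n} {m} G g =
  Σ (Subset n) λ S → ∣ S ∣ < n × (∀ i j → i ≢ j → col G (g i) (g j) ∈ S)

{-# OPTIONS --safe #-}

-- Let M be the given set of m vertices, c₀ a color missing on M, and H a
-- coloring of K_t, t = R_n(k-1,k,…,k) - 1, in which c₀ is the restricted color.
-- Color V × V ⊎ M × H with two copies (0,c), (1,c) of the n colors:
--   (v,w)–(v,w′)           (0, G w w′)
--   (v,w)–(v′,w′), v ≢ v′  (1, G v v′), except (0, c₀) if w ≡ w′ ∈ M and G v v′ ≡ c₀
--   (v,w)–(i,h)            (0, G w i) if w ≢ i, else (1, c₀)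
--   (i,h)–(j,h′)           (0, G i j) if i ≢ j, else (1, H h h′).
-- A (0,x)-clique either projects injectively to a clique of G through w and i,
-- or consists of points (v,w) with one fixed w ∈ M; a vertex (i,h) cannot
-- extend the latter because M has no c₀-edge.
-- A (1,x)-clique meeting both parts has x ≡ c₀, one i, and a single point
-- (v,i), because of the exception; so H would contain a c₀-clique on k-1 vertices.
module Submission where

open import Defs
open import Data.Nat using (ℕ; zero; suc; _+_; _*_; _∸_; _≤_; _<_; z≤n; s≤s)
open import Data.Nat.Properties
  using (≤-refl; ≤-trans; m∸n≤m; n<1+n; ≰⇒>; <-irrefl; +-comm)
open import Data.Fin using (Fin; zero; suc; _≟_; inject≤; punchIn; combine; remQuot)
open import Data.Fin.Properties
  using (¬Fin0; any?; inject≤-injective; punchIn-injective; punchInᵢ≢i; remQuot-combine; +↔⊎; *↔×)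
open import Data.Fin.Permutation using (Permutation; _⟨$⟩ʳ_; _⟨$⟩ˡ_; inverseˡ; transpose)
open import Data.Fin.Subset using (Subset; _∈_; _∉_; ∣_∣; ⊤)
open import Data.Fin.Subset.Properties using (_∈?_; p⊆q⇒∣p∣≤∣q∣; ∣⊤∣≡n)
open import Data.Product using (Σ; ∃; _×_; _,_; proj₁; proj₂)
open import Data.Sum using (_⊎_; inj₁; inj₂)
open import Data.Sum.Function.Propositional using (_⊎-↔_)
open import Function using (_∘_; _↔_; Injection; Inverse)
open import Function.Construct.Composition using (_↔-∘_)
open import Function.Definitions using (Injective)
open import Function.Properties.Inverse using (↔⇒↣)
open import Relation.Binary.PropositionalEquality
  using (_≡_; _≢_; refl; trans; cong; subst) renaming (sym to ≡-sym)
open import Relation.Nullary using (¬_; Dec; yes; no; contradiction)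
open import Relation.Nullary.Decidable using (_×-dec_; ¬?; decidable-stable)

-- Cliques and colorings over arbitrary vertex and color types.

Clique : {V C : Set} → (V → V → C) → C → ℕ → Set
Clique {V} col c k =
  Σ (Fin k → V) λ f → ∀ a b → a ≢ b → f a ≢ f b × col (f a) (f b) ≡ c

-- `Clique` asks for distinctness pair by pair, so that a single analysis of an edge yields both
-- distinct endpoints and the color. Decidable equality of indices turns this back into injectivity.
clique⇒mono : ∀ {s n k c} (G : Coloring s n) → Clique (col G) c k → MonoClique G c k
clique⇒mono G (f , p) =
  f ,
  (λ {a} {b} fa≡fb → decidable-stable (a ≟ b) λ a≢b → proj₁ (p a b a≢b) fa≡fb) ,
  λ a b a≢b → proj₂ (p a b a≢b)

mono-shrink : ∀ {s n j k c} (G : Coloring s n) → j ≤ k → MonoClique G c k → MonoClique G c j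
mono-shrink G j≤k (f , inj , mono) =
  (λ a → f (inject≤ a j≤k)) ,
  (λ e → inject≤-injective j≤k j≤k _ _ (inj e)) ,
  λ a b a≢b → mono _ _ λ e → a≢b (inject≤-injective j≤k j≤k a b e)

-- Renaming colors carries the clique bounds along. This serves to move the reduced bound from color
-- `zero` to any chosen color.
recolor : ∀ {s n ks} (π : Permutation n n) →
          HasRamseyColoring n ks s → HasRamseyColoring n (ks ∘ (π ⟨$⟩ˡ_)) s
recolor π (G , ramsey) =
  record { col = λ u v → π ⟨$⟩ʳ col G u v ; sym = λ u v → cong (π ⟨$⟩ʳ_) (sym G u v) } ,
  λ c (f , inj , mono) → ramsey (π ⟨$⟩ˡ c)
    (f , inj , λ a b a≢b → trans (≡-sym (inverseˡ π)) (cong (π ⟨$⟩ˡ_) (mono a b a≢b)))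

encode : ∀ {V : Set} {p n r k} (χ : V → V → Fin p × Fin n) → (∀ x y → χ x y ≡ χ y x) →
         (∀ c → ¬ Clique χ c k) → (ι : Fin r → V) → Injective _≡_ _≡_ ι →
         HasRamseyColoring (p * n) (diag (p * n) k) r
encode {n = n} χ χ-sym free ι ι-inj =
  record { col = λ u v → code (χ (ι u) (ι v)) ; sym = λ u v → cong code (χ-sym _ _) } ,
  λ c (f , inj , mono) → free (remQuot n c)
    (ι ∘ f ,
     λ a b a≢b → a≢b ∘ inj ∘ ι-inj ,
                 trans (≡-sym (remQuot-combine _ _)) (cong (remQuot n) (mono a b a≢b)))
  where
  code = λ (e , c) → combine e c

missing-element : ∀ {n} (S : Subset n) → ∣ S ∣ < n → ∃ λ c → c ∉ S
missing-element {n} S ∣S∣<n with any? (λ c → ¬? (c ∈? S))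
... | yes missing = missing
... | no full = contradiction (≤-trans ∣S∣<n n≤∣S∣) (<-irrefl refl)
  where
  n≤∣S∣ : n ≤ ∣ S ∣
  n≤∣S∣ = subst (_≤ ∣ S ∣) (∣⊤∣≡n n)
    (p⊆q⇒∣p∣≤∣q∣ {p = ⊤} λ {c} _ → decidable-stable (c ∈? S) λ c∉S → full (c , c∉S))

-- The coloring on base and extra vertices.

module Construction
  {k s m n t : ℕ} (G : Coloring s n) (H : Coloring t n)
  (g : Fin m → Fin s) (g-inj : Injective _≡_ _≡_ g) (c₀ : Fin n)
  (g-avoids : ∀ i j → i ≢ j → col G (g i) (g j) ≢ c₀)
  -- The forbidden size is written `suc k` because deleting one vertex of such a clique leaves the
  -- size `k` forbidden in `H-free₀`.
  (G-free : ∀ c → ¬ MonoClique G c (suc k))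
  (H-free : ∀ c → ¬ MonoClique H c (suc k))
  (H-free₀ : ¬ MonoClique H c₀ k)
  where

  Vertex : Set
  Vertex = (Fin s × Fin s) ⊎ (Fin m × Fin t)

  Color : Set
  Color = Fin 2 × Fin n

  pattern base v w = inj₁ (v , w)
  pattern extra i h = inj₂ (i , h)
  pattern outer c = zero , c
  pattern inner c = suc zero , c

  Exceptional : (v w v′ w′ : Fin s) → Set
  Exceptional v w v′ w′ = w ≡ w′ × col G v v′ ≡ c₀ × ∃ λ i → g i ≡ w

  exceptional? : ∀ v w v′ w′ → Dec (Exceptional v w v′ w′)
  exceptional? v w v′ w′ = w ≟ w′ ×-dec col G v v′ ≟ c₀ ×-dec any? λ i → g i ≟ w

  exceptional-sym : ∀ {v w v′ w′} → Exceptional v w v′ w′ → Exceptional v′ w′ v w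
  exceptional-sym (refl , e , w∈M) = refl , trans (sym G _ _) e , w∈M

  baseColor : (v w v′ w′ : Fin s) → Color
  baseColor v w v′ w′ with v ≟ v′ | exceptional? v w v′ w′
  ... | yes _ | _     = outer (col G w w′)
  ... | no _  | yes _ = outer c₀
  ... | no _  | no _  = inner (col G v v′)

  crossColor : Fin s → Fin m → Color
  crossColor w i with g i ≟ w
  ... | yes _ = inner c₀
  ... | no _  = outer (col G (g i) w)

  extraColor : Fin m → Fin t → Fin m → Fin t → Color
  extraColor i h j h′ with i ≟ j
  ... | yes _ = inner (col H h h′)
  ... | no _  = outer (col G (g i) (g j))

  color : Vertex → Vertex → Color
  color (base v w)  (base v′ w′) = baseColor v w v′ w′
  color (base v w)  (extra i h)  = crossColor w i
  color (extra i h) (base v w)   = crossColor w i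
  color (extra i h) (extra j h′) = extraColor i h j h′

  color-sym : ∀ x y → color x y ≡ color y x
  color-sym (base v w) (base v′ w′)
    -- The two orders of the edge branch on different tests; all are abstracted at once and the
    -- inconsistent outcomes refuted.
    with v ≟ v′ | v′ ≟ v | exceptional? v w v′ w′ | exceptional? v′ w′ v w
  ... | yes _    | yes _     | _     | _     = cong (λ c → outer c) (sym G w w′)
  ... | yes v≡v′ | no v′≢v   | _     | _     = contradiction (≡-sym v≡v′) v′≢v
  ... | no v≢v′  | yes v′≡v  | _     | _     = contradiction (≡-sym v′≡v) v≢v′
  ... | no _     | no _      | yes _ | yes _ = refl
  ... | no _     | no _      | yes e | no ¬e = contradiction (exceptional-sym e) ¬e
  ... | no _     | no _      | no ¬e | yes e = contradiction (exceptional-sym e) ¬e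
  ... | no _     | no _      | no _  | no _  = cong (λ c → inner c) (sym G v v′)
  color-sym (base v w)  (extra i h) = refl
  color-sym (extra i h) (base v w)  = refl
  color-sym (extra i h) (extra j h′) with i ≟ j | j ≟ i
  ... | yes _   | yes _   = cong (λ c → inner c) (sym H h h′)
  ... | yes i≡j | no j≢i  = contradiction (≡-sym i≡j) j≢i
  ... | no i≢j  | yes j≡i = contradiction (≡-sym j≡i) i≢j
  ... | no _    | no _    = cong (λ c → outer c) (sym G (g i) (g j))

  -- Recovering the type of an edge from its color.

  base-outer : ∀ {v w v′ w′ x} → baseColor v w v′ w′ ≡ outer x →
               (v ≡ v′ × col G w w′ ≡ x) ⊎ (v ≢ v′ × c₀ ≡ x × Exceptional v w v′ w′)
  base-outer {v} {w} {v′} {w′} eq with v ≟ v′ | exceptional? v w v′ w′ | eq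
  ... | yes v≡v′ | _     | refl = inj₁ (v≡v′ , refl)
  ... | no v≢v′  | yes e | refl = inj₂ (v≢v′ , refl , e)

  base-inner : ∀ {v w v′ w′ x} → baseColor v w v′ w′ ≡ inner x →
               v ≢ v′ × col G v v′ ≡ x × ¬ Exceptional v w v′ w′
  base-inner {v} {w} {v′} {w′} eq with v ≟ v′ | exceptional? v w v′ w′ | eq
  ... | no v≢v′ | no ¬e | refl = v≢v′ , refl , ¬e

  cross-outer : ∀ {w i x} → crossColor w i ≡ outer x → g i ≢ w × col G (g i) w ≡ x
  cross-outer {w} {i} eq with g i ≟ w | eq
  ... | no gi≢w | refl = gi≢w , refl

  cross-inner : ∀ {w i x} → crossColor w i ≡ inner x → g i ≡ w × c₀ ≡ x
  cross-inner {w} {i} eq with g i ≟ w | eq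
  ... | yes gi≡w | refl = gi≡w , refl

  extra-outer : ∀ {i h j h′ x} → extraColor i h j h′ ≡ outer x → i ≢ j × col G (g i) (g j) ≡ x
  extra-outer {i} {j = j} eq with i ≟ j | eq
  ... | no i≢j | refl = i≢j , refl

  extra-inner : ∀ {i h j h′ x} → extraColor i h j h′ ≡ inner x → i ≡ j × col H h h′ ≡ x
  extra-inner {i} {j = j} eq with i ≟ j | eq
  ... | yes i≡j | refl = i≡j , refl

  -- Cliques in outer colors.

  proj : Vertex → Fin s
  proj (base v w)  = w
  proj (extra i h) = g i

  outer-proj : ∀ x y {c} → color x y ≡ outer c → proj x ≢ proj y → col G (proj x) (proj y) ≡ c
  outer-proj (base v w) (base v′ w′) eq ne with base-outer {v} {w} eq
  ... | inj₁ (_ , e) = e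
  ... | inj₂ (_ , _ , w≡w′ , _) = contradiction w≡w′ ne
  outer-proj (base v w)  (extra i h)  eq ne = trans (sym G w (g i)) (proj₂ (cross-outer eq))
  outer-proj (extra i h) (base v w)   eq ne = proj₂ (cross-outer eq)
  outer-proj (extra i h) (extra j h′) eq ne = proj₂ (extra-outer {i} {h} eq)

  -- Outer edges at an extra vertex always have distinct projections, and base vertices agreeing in
  -- both coordinates are equal. Only an exceptional edge remains.
  outer-collision : ∀ x y {c} → x ≢ y → color x y ≡ outer c → proj x ≡ proj y →
    c₀ ≡ c × ∃ λ i → ∃ λ v → ∃ λ v′ → v ≢ v′ × x ≡ base v (g i) × y ≡ base v′ (g i)
  outer-collision (base v w) (base v′ w) ne eq refl with base-outer {v} {w} eq
  ... | inj₁ (refl , _) = contradiction refl ne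
  ... | inj₂ (v≢v′ , c₀≡c , _ , _ , i , refl) = c₀≡c , i , v , v′ , v≢v′ , refl , refl
  outer-collision (base v w)  (extra i h)  ne eq e = contradiction (≡-sym e) (proj₁ (cross-outer eq))
  outer-collision (extra i h) (base v w)   ne eq e = contradiction e (proj₁ (cross-outer eq))
  outer-collision (extra i h) (extra j h′) ne eq e =
    contradiction (g-inj e) (proj₁ (extra-outer {i} {h} eq))

  -- A base vertex cannot share its first coordinate with both given points, so one of the two edges
  -- is exceptional and fixes its second coordinate. An extra vertex would require an edge of color
  -- `c₀` inside the image of `g`.
  outer-column : ∀ {v v′ i} z → v ≢ v′ →
    color (base v (g i)) z ≡ outer c₀ → color (base v′ (g i)) z ≡ outer c₀ →
    ∃ λ u → z ≡ base u (g i)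
  outer-column {v} {v′} {i} (base u w) v≢v′ eq eq′
    with base-outer {v} {g i} eq | base-outer {v′} {g i} eq′
  ... | inj₁ (v≡u , _) | inj₁ (v′≡u , _) = contradiction (trans v≡u (≡-sym v′≡u)) v≢v′
  ... | inj₂ (_ , _ , refl , _) | _ = u , refl
  ... | inj₁ _ | inj₂ (_ , _ , refl , _) = u , refl
  outer-column {i = i} (extra j h) _ eq _ with cross-outer eq
  ... | gj≢gi , e = contradiction e (g-avoids j i (gj≢gi ∘ cong g))

  -- Distinct points of one column differ in the first coordinate, so each outer edge between them
  -- is exceptional and `G` gives the first coordinates color `c₀`.
  column-clique : ∀ {c w j} ((f , p) : Clique color (outer c) j) →
    (∀ a → ∃ λ v → f a ≡ base v w) → Clique (col G) c j
  column-clique {c} {w} (f , p) column = q , pair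
    where
    q = λ a → proj₁ (column a)

    pair : ∀ a b → a ≢ b → q a ≢ q b × col G (q a) (q b) ≡ c
    pair a b a≢b with column a | column b | p a b a≢b
    ... | v , ea | v′ , eb | fa≢fb , eq rewrite ea | eb with base-outer {v} {w} eq
    ... | inj₁ (refl , _) = contradiction refl fa≢fb
    ... | inj₂ (v≢v′ , c₀≡c , _ , e , _) = v≢v′ , trans e c₀≡c

  outer-free : ∀ c → ¬ Clique color (outer c) (suc k)
  outer-free c (f , p)
    with any? (λ a → any? (λ b → ¬? (a ≟ b) ×-dec proj (f a) ≟ proj (f b)))
  ... | no injective = G-free c (clique⇒mono G (proj ∘ f , pair))
    where
    pair : ∀ a b → a ≢ b → proj (f a) ≢ proj (f b) × col G (proj (f a)) (proj (f b)) ≡ c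
    pair a b a≢b = ne , outer-proj (f a) (f b) (proj₂ (p a b a≢b)) ne
      where
      ne : proj (f a) ≢ proj (f b)
      ne e = injective (a , b , a≢b , e)
  ... | yes (a , b , a≢b , e)
    with outer-collision (f a) (f b) (proj₁ (p a b a≢b)) (proj₂ (p a b a≢b)) e
  -- A collision forces `c` to be `c₀`, the color that `outer-column` needs.
  ... | refl , i , v , v′ , v≢v′ , ea , eb =
    G-free c (clique⇒mono G (column-clique (f , p) column))
    where
    edge : ∀ {x a} l → f a ≡ x → l ≢ a → color x (f l) ≡ outer c₀
    edge l refl l≢a = proj₂ (p _ l (l≢a ∘ ≡-sym))

    column : ∀ l → ∃ λ u → f l ≡ base u (g i)
    column l with l ≟ a | l ≟ b
    -- The colliding vertices have no edge to themselves; their places in the column come from the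
    -- collision.
    ... | yes refl | _        = v , ea
    ... | no _     | yes refl = v′ , eb
    ... | no l≢a   | no l≢b   = outer-column (f l) v≢v′ (edge l ea l≢a) (edge l eb l≢b)

  -- Cliques in inner colors.

  IsBase IsExtra : Vertex → Set
  IsBase x  = ∃ λ v → ∃ λ w → x ≡ base v w
  IsExtra x = ∃ λ i → ∃ λ h → x ≡ extra i h

  base? : ∀ x → Dec (IsBase x)
  base? (base v w)  = yes (v , w , refl)
  base? (extra i h) = no λ ()

  ¬base⇒extra : ∀ x → ¬ IsBase x → IsExtra x
  ¬base⇒extra (base v w)  ¬b = contradiction (v , w , refl) ¬b
  ¬base⇒extra (extra i h) _  = i , h , refl

  base-clique : ∀ {c j} ((f , p) : Clique color (inner c) j) →
    (∀ a → IsBase (f a)) → Clique (col G) c j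
  base-clique {c} (f , p) bases = q , pair
    where
    q = λ a → proj₁ (bases a)

    pair : ∀ a b → a ≢ b → q a ≢ q b × col G (q a) (q b) ≡ c
    pair a b a≢b with bases a | bases b | p a b a≢b
    ... | v , w , ea | v′ , w′ , eb | _ , eq rewrite ea | eb with base-inner {v} {w} eq
    ... | v≢v′ , e , _ = v≢v′ , e

  -- Inner edges between extra vertices stay within one copy of `H`, so distinct vertices differ in
  -- their `H` coordinate.
  extra-clique : ∀ {c j} ((f , p) : Clique color (inner c) j) →
    (∀ a → IsExtra (f a)) → Clique (col H) c j
  extra-clique {c} (f , p) extras = q , pair
    where
    q = λ a → proj₁ (proj₂ (extras a))

    pair : ∀ a b → a ≢ b → q a ≢ q b × col H (q a) (q b) ≡ c
    pair a b a≢b with extras a | extras b | p a b a≢b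
    ... | i , h , ea | j , h′ , eb | fa≢fb , eq rewrite ea | eb with extra-inner {i} {h} eq
    ... | refl , e = (λ { refl → fa≢fb refl }) , e

  -- If `y` were base, both second coordinates would equal `g i` and the first coordinates would
  -- have `G`-color `c₀`. That edge is exceptional, hence outer.
  inner-mixed : ∀ {c v w i h} y → color (base v w) (extra i h) ≡ inner c →
    color (base v w) y ≡ inner c → color y (extra i h) ≡ inner c → IsExtra y
  inner-mixed {v = v} {w} (base v′ w′) eq₁ eq₂ eq₃
    with cross-inner eq₁ | base-inner {v} {w} eq₂ | cross-inner eq₃
  ... | gi≡w , c₀≡c | _ , e , ¬exc | gi≡w′ , _ =
    contradiction (trans (≡-sym gi≡w) gi≡w′ , trans e (≡-sym c₀≡c) , _ , gi≡w) ¬exc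
  inner-mixed (extra j h) _ _ _ = j , h , refl

  inner-free : ∀ c → ¬ Clique color (inner c) (suc k)
  inner-free c (f , p) with any? (λ a → base? (f a))
  ... | no ¬bases = H-free c (clique⇒mono H (extra-clique (f , p) extras))
    where
    extras : ∀ a → IsExtra (f a)
    extras a = ¬base⇒extra (f a) λ b → ¬bases (a , b)
  ... | yes (a , v , w , ea) with any? (λ b → ¬? (base? (f b)))
  ... | no bases =
    G-free c (clique⇒mono G (base-clique (f , p) λ b →
      decidable-stable (base? (f b)) λ ¬b → bases (b , ¬b)))
  ... | yes (b , ¬base) with ¬base⇒extra (f b) ¬base
  -- A cross edge has an inner color only when that color is `c₀`, so the clique found in `H` has
  -- color `c₀`.
  ... | i , h , eb = H-free₀ (clique⇒mono H (subst (λ d → Clique (col H) d k)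
      (≡-sym (proj₂ (cross-inner {w} {i} ab))) (extra-clique rest extras)))
    where
    a≢b : a ≢ b
    a≢b refl = ¬base (v , w , ea)

    edge : ∀ {x y a b} → f a ≡ x → f b ≡ y → a ≢ b → color x y ≡ inner c
    edge refl refl a≢b = proj₂ (p _ _ a≢b)

    ab : color (base v w) (extra i h) ≡ inner c
    ab = edge ea eb a≢b

    rest : Clique color (inner c) k
    rest = f ∘ punchIn a , λ l l′ l≢l′ → p _ _ (l≢l′ ∘ punchIn-injective a l l′)

    extras : ∀ l → IsExtra (f (punchIn a l))
    extras l with punchIn a l ≟ b
    -- `b` is extra by choice; `inner-mixed` would need an edge from `b` to itself.
    ... | yes e = i , h , trans (cong f e) eb
    ... | no l≢b = inner-mixed {v = v} {h = h} (f (punchIn a l)) ab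
      (edge ea refl (punchInᵢ≢i a l ∘ ≡-sym)) (edge refl eb l≢b)

  color-free : ∀ c → ¬ Clique color c (suc k)
  color-free (outer c) = outer-free c
  color-free (inner c) = inner-free c

  vertices : Fin (s * s + m * t) ↔ Vertex
  vertices = (*↔× ⊎-↔ *↔×) ↔-∘ +↔⊎

  -- Every smaller `r` is covered because `IsRamseyNumber` denies a coloring only at the Ramsey
  -- number itself.
  hasRamseyColoring : ∀ {r} → r ≤ s * s + m * t → HasRamseyColoring (2 * n) (diag (2 * n) (suc k)) r
  hasRamseyColoring r≤N = encode color color-sym color-free
    (λ u → Inverse.to vertices (inject≤ u r≤N))
    (λ e → inject≤-injective r≤N r≤N _ _ (Injection.injective (↔⇒↣ vertices) e))

-- From Ramsey numbers to colorings.

firstMinus≤k : ∀ {n k} c → firstMinus n k c ≤ k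
firstMinus≤k {k = k} zero    = m∸n≤m k 1
firstMinus≤k         (suc c) = ≤-refl

0<firstMinus : ∀ {n k} → 2 ≤ k → ∀ c → 0 < firstMinus n k c
0<firstMinus (s≤s (s≤s z≤n)) zero    = s≤s z≤n
0<firstMinus (s≤s (s≤s z≤n)) (suc c) = s≤s z≤n

empty-ramsey : ∀ {n ks} → (∀ c → 0 < ks c) → HasRamseyColoring n ks 0
empty-ramsey pos =
  record { col = λ () ; sym = λ () } , λ c (f , _) → ¬Fin0 (f (inject≤ zero (pos c)))

-- `IsRamseyNumber` supplies colorings only of positive order, so `r` equal to 1 is settled by the
-- empty graph, where positive bounds exclude every clique.
ramsey-pred : ∀ {n ks r} → (∀ c → 0 < ks c) → IsRamseyNumber n ks r →
              HasRamseyColoring n ks (r ∸ 1)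
ramsey-pred {r = suc zero}    pos _                 = empty-ramsey pos
ramsey-pred {r = suc (suc r)} pos (_ , _ , smaller) = smaller (suc r) (s≤s z≤n) (n<1+n _)

theorem2 : (k n m s : ℕ) → 2 ≤ k → 2 ≤ n → 2 ≤ m → 2 ≤ s
    → (G : Coloring s n) → IsRamseyColoring (diag n k) G
    → (g : Fin m → Fin s) → Injective _≡_ _≡_ g → FewerColorsOn G g
    → (r₁ r₂ : ℕ) → IsRamseyNumber (2 * n) (diag (2 * n) k) r₁
    → IsRamseyNumber n (firstMinus n k) r₂
    → s * s + m * (r₂ ∸ 1) + 1 ≤ r₁
theorem2 (suc k) (suc n) m s 2≤k 2≤n 2≤m 2≤s G G-free g g-inj (S , ∣S∣<n , g∈S) r₁ r₂
  (_ , none , _) R₂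
  with missing-element S ∣S∣<n
... | c₀ , c₀∉S
  -- `firstMinus` lowers the bound of color `zero`; the transposition moves this to the missing
  -- color.
  with recolor (transpose zero c₀) (ramsey-pred (0<firstMinus 2≤k) R₂)
... | H , H-ramsey =
  subst (_≤ r₁) (+-comm 1 _) (≰⇒> λ r₁≤N → none (hasRamseyColoring r₁≤N))
  where
  open Construction G H g g-inj c₀
    (λ i j i≢j e → c₀∉S (subst (_∈ S) e (g∈S i j i≢j)))
    G-free
    (λ c → H-ramsey c ∘ mono-shrink H (firstMinus≤k (transpose zero c₀ ⟨$⟩ˡ c)))
    -- The transposition sends `zero` to `c₀`, so the bound at `c₀` is `firstMinus` at `zero`, which
    -- computes to `k`.
    (subst (λ z → ¬ MonoClique H c₀ (firstMinus (suc n) (suc k) z))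
      (inverseˡ (transpose zero c₀)) (H-ramsey c₀))
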